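{- Let $n\in\mathbb{N}$, $n>1$, and let $f\in\mathcal{G}$. Then $$d^{(n)}(x,y)=\begin{cases}0&\text{for }x=y,\\ f(\gcd(x,n))+f(\gcd(y,n))&\text{for }x\ne y,\end{cases}\qquad x,y\in\mathbb{Z},$$ is a pseudometric on $\mathbb{Z}$, and so also on $D_n$. If $f\in\mathcal{G}_0$, then $d^{(n)}$ is a metric on $D_n$.
   Context: $\mathbb{N}$ is the set of positive integers and $D_n=\{x\in\mathbb{N}: x\mid n\}$. $\mathcal{G}$ is the set of functions $f:\mathbb{N}\to\mathbb{R}$ with $f(1)=0$ and $f(x)\ge0$ for all $x>1$; $\mathcal{G}_0$ is the set of $f\in\mathcal{G}$ with $f(x)>0$ for all $x>1$. A pseudometric on $S$ is a function $d:S\times S\to\mathbb{R}$ with $d(x,x)=0$, $d(x,y)=d(y,x)$ and $d(x,z)\le d(x,y)+d(y,z)$; it is a metric if moreover $d(x,y)=0\Rightarrow x=y$. -}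

module Defs where

open import Data.Bool.Base using (if_then_else_)
open import Data.Integer.Base as ℤ using (ℤ; +_)
open import Data.Integer.GCD using (gcd)
open import Data.Integer.Properties as ℤ using ()
import Data.Integer.Tactic.RingSolver as ℤSolver
open import Data.Irrelevant using ([_])
open import Data.Nat.Base as ℕ using (ℕ; suc; NonZero)
open import Data.Nat.Divisibility using (_∣_)
open import Data.Nat.GCD using (gcd[m,n]≢0)
open import Data.Product using (_×_; ∃)
open import Data.Rational.Base as ℚ using (ℚ; 0ℚ)
open import Data.Rational.Properties as ℚ using ()
open import Data.Rational.Solver using (module +-*-Solver)
import Data.Rational.Unnormalised as ℚᵘ
import Data.Rational.Unnormalised.Properties as ℚᵘ
open import Data.Refinement using (Refinement; Refinement-syntax; value; _,_)
open import Data.Sum using (inj₂)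
open import Function.Base using (_on_)
open import Function.Metric.Core using (DistanceFunction)
open import Function.Metric.Definitions
  using (Indiscernable; Symmetric; TriangleInequality)
open import Relation.Binary.PropositionalEquality using (_≡_; refl; cong; cong₂)
open import Relation.Nullary.Decidable using (does)

------------------------------------------------------------------------
-- Real numbers

-- Bishop's constructive reals: regular sequences of rationals.  The index
-- starts at 0, so that the n-th term is within 1/(n+1) of the limit.

ε : ℕ → ℚ
ε n = + 1 ℚ./ suc n

record ℝ : Set where
  constructor mkℝ
  field
    seq     : ℕ → ℚ
    regular : ∀ m n → ℚ.∣ seq m ℚ.- seq n ∣ ℚ.≤ ε m ℚ.+ ε n

open ℝ public

infix 4 _≈ℝ_ _≤ℝ_ _<ℝ_
infixl 6 _+ℝ_

-- Two reals are equal when they have the same limit; this is coarser than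
-- propositional equality of the representing sequences.

_≈ℝ_ : ℝ → ℝ → Set
x ≈ℝ y = ∀ n → ℚ.∣ seq x n ℚ.- seq y n ∣ ℚ.≤ ε n ℚ.+ ε n

_≤ℝ_ : ℝ → ℝ → Set
x ≤ℝ y = ∀ n → seq x n ℚ.- seq y n ℚ.≤ ε n ℚ.+ ε n

_<ℝ_ : ℝ → ℝ → Set
x <ℝ y = ∃ λ n → ε n ℚ.+ ε n ℚ.< seq y n ℚ.- seq x n

0ℝ : ℝ
0ℝ = mkℝ (λ _ → 0ℚ) λ m n →
  ℚ.+-mono-≤ {0ℚ} {ε m} {0ℚ} {ε n} (0≤ε m) (0≤ε n)
  where
  0≤ε : ∀ n → 0ℚ ℚ.≤ ε n
  0≤ε n = ℚ.nonNegative⁻¹ (ε n) {{ℚ.normalize-nonNeg 1 (suc n)}}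

-- Since 1/(2n+2) + 1/(2n+2) = 1/(n+1), termwise addition must read its
-- arguments at index 2n+1 in order to be regular.

double : ℕ → ℕ
double n = suc (n ℕ.+ n)

ε-double : ∀ n → ε (double n) ℚ.+ ε (double n) ≡ ε n
ε-double n = ℚ.toℚᵘ-injective (begin
  ℚ.toℚᵘ (ε d ℚ.+ ε d)            ≈⟨ ℚ.toℚᵘ-homo-+ (ε d) (ε d) ⟩
  ℚ.toℚᵘ (ε d) ℚᵘ.+ ℚ.toℚᵘ (ε d)  ≈⟨ ℚᵘ.+-cong (toℚᵘ-ε d) (toℚᵘ-ε d) ⟩
  εᵘ d ℚᵘ.+ εᵘ d                  ≈⟨ ℚᵘ.*≡* cross ⟩
  εᵘ n                            ≈⟨ toℚᵘ-ε n ⟨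
  ℚ.toℚᵘ (ε n)                    ∎)
  where
  open ℚᵘ.≃-Reasoning
  d = double n

  εᵘ : ℕ → ℚᵘ.ℚᵘ
  εᵘ k = ℚᵘ.mkℚᵘ (+ 1) k

  toℚᵘ-ε : ∀ k → ℚ.toℚᵘ (ε k) ℚᵘ.≃ εᵘ k
  toℚᵘ-ε k = ℚ.toℚᵘ-fromℚᵘ (εᵘ k)

  identity : ∀ a → (+ 1 ℤ.* (+ 2 ℤ.+ (a ℤ.+ a)) ℤ.+ + 1 ℤ.* (+ 2 ℤ.+ (a ℤ.+ a))) ℤ.* (+ 1 ℤ.+ a)
                 ≡ + 1 ℤ.* ((+ 2 ℤ.+ (a ℤ.+ a)) ℤ.* (+ 2 ℤ.+ (a ℤ.+ a)))
  identity = ℤSolver.solve-∀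

  cross : (+ 1 ℤ.* + suc d ℤ.+ + 1 ℤ.* + suc d) ℤ.* + suc n
        ≡ + 1 ℤ.* (+ suc d ℤ.* + suc d)
  cross = identity (+ n)

_+ℝ_ : ℝ → ℝ → ℝ
x +ℝ y = mkℝ (λ n → seq x (double n) ℚ.+ seq y (double n)) reg
  where
  open +-*-Solver

  interchange : ∀ a b c e → (a ℚ.+ b) ℚ.+ (c ℚ.+ e) ≡ (a ℚ.+ c) ℚ.+ (b ℚ.+ e)
  interchange = solve 4 (λ a b c e →
    (a :+ b) :+ (c :+ e) := (a :+ c) :+ (b :+ e)) refl

  difference : ∀ a b c e → (a ℚ.+ b) ℚ.- (c ℚ.+ e) ≡ (a ℚ.- c) ℚ.+ (b ℚ.- e)
  difference = solve 4 (λ a b c e →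
    (a :+ b) :- (c :+ e) := (a :- c) :+ (b :- e)) refl

  reg : ∀ m n →
        ℚ.∣ (seq x (double m) ℚ.+ seq y (double m)) ℚ.- (seq x (double n) ℚ.+ seq y (double n)) ∣
          ℚ.≤ ε m ℚ.+ ε n
  reg m n = begin
    ℚ.∣ (x₁ ℚ.+ y₁) ℚ.- (x₂ ℚ.+ y₂) ∣        ≡⟨ cong ℚ.∣_∣ (difference x₁ y₁ x₂ y₂) ⟩
    ℚ.∣ (x₁ ℚ.- x₂) ℚ.+ (y₁ ℚ.- y₂) ∣        ≤⟨ ℚ.∣p+q∣≤∣p∣+∣q∣ (x₁ ℚ.- x₂) (y₁ ℚ.- y₂) ⟩
    ℚ.∣ x₁ ℚ.- x₂ ∣ ℚ.+ ℚ.∣ y₁ ℚ.- y₂ ∣      ≤⟨ ℚ.+-mono-≤ (regular x m′ n′) (regular y m′ n′) ⟩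
    (ε m′ ℚ.+ ε n′) ℚ.+ (ε m′ ℚ.+ ε n′)      ≡⟨ interchange (ε m′) (ε n′) (ε m′) (ε n′) ⟩
    (ε m′ ℚ.+ ε m′) ℚ.+ (ε n′ ℚ.+ ε n′)      ≡⟨ cong₂ ℚ._+_ (ε-double m) (ε-double n) ⟩
    ε m ℚ.+ ε n                              ∎
    where
    open ℚ.≤-Reasoning
    m′ = double m
    n′ = double n
    x₁ = seq x m′
    x₂ = seq x n′
    y₁ = seq y m′
    y₂ = seq y n′

------------------------------------------------------------------------
-- Pseudometrics and metrics

record IsPseudometric {S : Set} (d : DistanceFunction S ℝ) : Set where
  field
    self-zero : ∀ x → d x x ≈ℝ 0ℝ
    sym       : Symmetric _≈ℝ_ d
    triangle  : TriangleInequality _≤ℝ_ _+ℝ_ d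

record IsMetric {S : Set} (d : DistanceFunction S ℝ) : Set where
  field
    isPseudometric : IsPseudometric d
    indiscernable  : Indiscernable _≡_ _≈ℝ_ d 0ℝ

------------------------------------------------------------------------
-- Positive integers, divisors and the classes 𝒢, 𝒢₀

-- Membership proofs in a refinement type are irrelevant, so elements of
-- ℕ⁺ and of D n are propositionally equal as soon as their underlying
-- numbers are.

ℕ⁺ : Set
ℕ⁺ = [ n ∈ ℕ ∣ NonZero n ]

1⁺ : ℕ⁺
1⁺ = 1 , [ _ ]

D : ℕ⁺ → Set
D n = [ x ∈ ℕ⁺ ∣ (value x ∣ value n) ]

D→ℤ : ∀ {n} → D n → ℤ
D→ℤ x = + value (value x)

record 𝒢 (f : ℕ⁺ → ℝ) : Set where
  field
    f1≈0 : f 1⁺ ≈ℝ 0ℝ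
    f≥0  : ∀ x → 1 ℕ.< value x → 0ℝ ≤ℝ f x

record 𝒢₀ (f : ℕ⁺ → ℝ) : Set where
  field
    f∈𝒢 : 𝒢 f
    f>0 : ∀ x → 1 ℕ.< value x → 0ℝ <ℝ f x

------------------------------------------------------------------------
-- The distance function

gcd⁺ : ℤ → ℕ⁺ → ℕ⁺
gcd⁺ x (n , [ n≢0 ]) =
  ℤ.∣ gcd x (+ n) ∣ ,
  [ ℕ.≢-nonZero (gcd[m,n]≢0 ℤ.∣ x ∣ n (inj₂ (ℕ.≢-nonZero⁻¹ n {{n≢0}}))) ]

dist : (ℕ⁺ → ℝ) → ℕ⁺ → DistanceFunction ℤ ℝ
dist f n x y = if does (x ℤ.≟ y) then 0ℝ else f (gcd⁺ x n) +ℝ f (gcd⁺ y n)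

distD : (ℕ⁺ → ℝ) → (n : ℕ⁺) → DistanceFunction (D n) ℝ
distD f n = dist f n on D→ℤ {n}

{-# OPTIONS --safe #-}

-- On distinct arguments the distance is a sum g x + g y of nonnegative
-- quantities, so for distinct x, y, z the triangle inequality is
-- g x + g z ≤ (g x + g y) + (g y + g z); when two of the three points
-- coincide it only says that the distance is nonnegative.  On D n we have
-- gcd(x, n) = x, and of two distinct divisors at least one exceeds 1, so for
-- f in 𝒢₀ their distance is positive.

module Submission where

open import Defs
open import Data.Bool.Base using (if_then_else_)
open import Data.Empty using (⊥)
open import Data.Integer.Base as ℤ using (ℤ; +_; +[1+_]; +0; -[1+_])
import Data.Integer.Properties as ℤ
open import Data.Irrelevant using ([_])
open import Data.Nat as ℕ using (ℕ; suc; _<_; s≤s; z≤n)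
open import Data.Nat.Divisibility using (_∣_; _∣?_; ∣-antisym; ∣-refl)
open import Data.Nat.GCD using (gcd; gcd[m,n]∣m; gcd-greatest)
import Data.Nat.Properties as ℕ
open import Data.Product using (_×_; _,_)
open import Data.Rational.Base as ℚ using (ℚ; mkℚ; 0ℚ)
import Data.Rational.Properties as ℚ
open import Data.Rational.Solver using (module +-*-Solver)
import Data.Rational.Unnormalised as ℚᵘ
import Data.Rational.Unnormalised.Properties as ℚᵘ
open import Data.Refinement as Refinement using (value; value-injective; _,_)
open import Data.Sum using (_⊎_; inj₁; inj₂)
open import Function.Base using (_on_)
open import Function.Metric.Core using (DistanceFunction)
open import Relation.Binary.Definitions using (DecidableEquality)
open import Relation.Binary.PropositionalEquality
  using (_≡_; _≢_; refl; sym; trans; cong; cong₂; subst; subst₂)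
open import Relation.Nullary using (¬_; Dec; yes; no)
open import Relation.Nullary.Decidable
  using (does; recompute; dec-true; dec-false; decidable-stable)

open +-*-Solver using (solve; _:+_; _:-_; :-_; _:=_)

-- The error bounds ε

0≤ε : ∀ n → 0ℚ ℚ.≤ ε n
0≤ε n = ℚ.nonNegative⁻¹ (ε n) {{ℚ.normalize-nonNeg 1 (suc n)}}

ε-double≤ε : ∀ n → ε (double n) ℚ.≤ ε n
ε-double≤ε n = begin
  ε d             ≡⟨ ℚ.+-identityʳ (ε d) ⟨
  ε d ℚ.+ 0ℚ      ≤⟨ ℚ.+-monoʳ-≤ (ε d) (0≤ε d) ⟩
  ε d ℚ.+ ε d     ≡⟨ ε-double n ⟩
  ε n             ∎
  where
  open ℚ.≤-Reasoning
  d = double n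

-- A positive rational with denominator `d + 1` is at least 1/(d+1), because its numerator is at
-- least 1. The index `suc d` gives `ε (suc d)` = 1/(d+2), which is strictly smaller.
ε<positive : ∀ r → 0ℚ ℚ.< r → ε (suc (ℚ.denominator-1 r)) ℚ.< r
ε<positive (mkℚ +[1+ a ] d c) _ = ℚ.toℚᵘ-cancel-<
  (ℚᵘ.<-respˡ-≃ (ℚᵘ.≃-sym (ℚ.toℚᵘ-fromℚᵘ (ℚᵘ.mkℚᵘ (+ 1) (suc d))))
    (ℚᵘ.*<* (ℤ.+<+ (s≤s (s≤s (ℕ.≤-trans
      (ℕ.≤-reflexive (ℕ.+-identityʳ d)) (ℕ.m≤m+n d (a ℕ.* suc (suc d)))))))))
ε<positive (mkℚ +0 d c) (ℚ.*<* (ℤ.+<+ ()))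
ε<positive (mkℚ -[1+ a ] d c) (ℚ.*<* ())

-- If `q < p`, some `ε k` would be smaller than the gap `p - q`, against the bound at that `k`. This
-- is what lets a comparison of reals pass through arbitrarily late terms.
≤-archimedean : ∀ {p q} → (∀ k → p ℚ.≤ q ℚ.+ ε k) → p ℚ.≤ q
≤-archimedean {p} {q} p≤q+ε = ℚ.≮⇒≥ λ q<p → ℚ.<-irrefl refl (begin-strict
  p                   ≤⟨ p≤q+ε (suc (ℚ.denominator-1 (p ℚ.- q))) ⟩
  q ℚ.+ ε (suc (ℚ.denominator-1 (p ℚ.- q)))
                      <⟨ ℚ.+-monoʳ-< q (ε<positive (p ℚ.- q) (0<p-q q<p)) ⟩
  q ℚ.+ (p ℚ.- q)     ≡⟨ solve 2 (λ p q → q :+ (p :- q) := p) refl p q ⟩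
  p                   ∎)
  where
  open ℚ.≤-Reasoning
  0<p-q : q ℚ.< p → 0ℚ ℚ.< p ℚ.- q
  0<p-q q<p = subst (ℚ._< p ℚ.- q) (ℚ.+-inverseʳ q) (ℚ.+-monoˡ-< (ℚ.- q) q<p)

p≤∣p∣ : ∀ p → p ℚ.≤ ℚ.∣ p ∣
p≤∣p∣ p with ℚ.≤-total 0ℚ p
... | inj₁ 0≤p = ℚ.≤-reflexive (sym (ℚ.0≤p⇒∣p∣≡p 0≤p))
... | inj₂ p≤0 = ℚ.≤-trans p≤0 (ℚ.0≤∣p∣ p)

-- Order and addition of reals

regular-≤ : ∀ x m n → seq x m ℚ.- seq x n ℚ.≤ ε m ℚ.+ ε n
regular-≤ x m n = ℚ.≤-trans (p≤∣p∣ _) (regular x m n)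

≈ℝ-refl : ∀ x → x ≈ℝ x
≈ℝ-refl x n = regular x n n

≈ℝ-sym : ∀ x y → x ≈ℝ y → y ≈ℝ x
≈ℝ-sym x y x≈y n = begin
  ℚ.∣ y′ ℚ.- x′ ∣          ≡⟨ cong ℚ.∣_∣ neg-difference ⟨
  ℚ.∣ ℚ.- (x′ ℚ.- y′) ∣    ≡⟨ ℚ.∣-p∣≡∣p∣ (x′ ℚ.- y′) ⟩
  ℚ.∣ x′ ℚ.- y′ ∣          ≤⟨ x≈y n ⟩
  ε n ℚ.+ ε n              ∎
  where
  open ℚ.≤-Reasoning
  x′ = seq x n
  y′ = seq y n
  neg-difference : ℚ.- (x′ ℚ.- y′) ≡ y′ ℚ.- x′
  neg-difference = solve 2 (λ x y → :- (x :- y) := y :- x) refl x′ y′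

≈ℝ⇒≤ℝ : ∀ x y → x ≈ℝ y → x ≤ℝ y
≈ℝ⇒≤ℝ x y x≈y n = ℚ.≤-trans (p≤∣p∣ _) (x≈y n)

≤ℝ-refl : ∀ x → x ≤ℝ x
≤ℝ-refl x = ≈ℝ⇒≤ℝ x x (≈ℝ-refl x)

-- Comparing x and z at index n through a far index m costs 6 ε m; a further
-- 2 ε m of slack makes this the single error ε k for m = 8 k + 7.
≤ℝ-trans : ∀ x y z → x ≤ℝ y → y ≤ℝ z → x ≤ℝ z
≤ℝ-trans x y z x≤y y≤z n = ≤-archimedean bound
  where
  open ℚ.≤-Reasoning
  bound : ∀ k → seq x n ℚ.- seq z n ℚ.≤ (ε n ℚ.+ ε n) ℚ.+ ε k
  bound k = begin
    seq x n ℚ.- seq z n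
      ≡⟨ solve 5 (λ xₙ xₘ yₘ zₘ zₙ →
           xₙ :- zₙ := (((xₙ :- xₘ) :+ (xₘ :- yₘ)) :+ (yₘ :- zₘ)) :+ ((zₘ :- zₘ) :+ (zₘ :- zₙ)))
           refl (seq x n) (seq x m) (seq y m) (seq z m) (seq z n) ⟩
    (((seq x n ℚ.- seq x m) ℚ.+ (seq x m ℚ.- seq y m)) ℚ.+ (seq y m ℚ.- seq z m))
      ℚ.+ ((seq z m ℚ.- seq z m) ℚ.+ (seq z m ℚ.- seq z n))
      ≤⟨ ℚ.+-mono-≤
           (ℚ.+-mono-≤ (ℚ.+-mono-≤ (regular-≤ x n m) (x≤y m)) (y≤z m))
           (ℚ.+-mono-≤ (regular-≤ z m m) (regular-≤ z m n)) ⟩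
    (((ε n ℚ.+ ε m) ℚ.+ (ε m ℚ.+ ε m)) ℚ.+ (ε m ℚ.+ ε m)) ℚ.+ ((ε m ℚ.+ ε m) ℚ.+ (ε m ℚ.+ ε n))
      ≡⟨ solve 2 (λ a e →
           (((a :+ e) :+ (e :+ e)) :+ (e :+ e)) :+ ((e :+ e) :+ (e :+ a)) :=
           (a :+ a) :+ (((e :+ e) :+ (e :+ e)) :+ ((e :+ e) :+ (e :+ e))))
           refl (ε n) (ε m) ⟩
    (ε n ℚ.+ ε n) ℚ.+ (((ε m ℚ.+ ε m) ℚ.+ (ε m ℚ.+ ε m)) ℚ.+ ((ε m ℚ.+ ε m) ℚ.+ (ε m ℚ.+ ε m)))
      ≡⟨ cong ((ε n ℚ.+ ε n) ℚ.+_) 8ε ⟩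
    (ε n ℚ.+ ε n) ℚ.+ ε k ∎
    where
    m = double (double (double k))
    twice : ℚ → ℚ
    twice p = p ℚ.+ p
    8ε : twice (twice (twice (ε m))) ≡ ε k
    8ε = trans (cong (λ p → twice (twice p)) (ε-double (double (double k))))
           (trans (cong twice (ε-double (double k))) (ε-double k))

+ℝ-mono-≤ : ∀ x y u v → x ≤ℝ y → u ≤ℝ v → (x +ℝ u) ≤ℝ (y +ℝ v)
+ℝ-mono-≤ x y u v x≤y u≤v n = begin
  (seq x d ℚ.+ seq u d) ℚ.- (seq y d ℚ.+ seq v d)
    ≡⟨ solve 4 (λ x u y v → (x :+ u) :- (y :+ v) := (x :- y) :+ (u :- v))
         refl (seq x d) (seq u d) (seq y d) (seq v d) ⟩
  (seq x d ℚ.- seq y d) ℚ.+ (seq u d ℚ.- seq v d)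
    ≤⟨ ℚ.+-mono-≤ (x≤y d) (u≤v d) ⟩
  (ε d ℚ.+ ε d) ℚ.+ (ε d ℚ.+ ε d)
    ≡⟨ cong₂ ℚ._+_ (ε-double n) (ε-double n) ⟩
  ε n ℚ.+ ε n ∎
  where
  open ℚ.≤-Reasoning
  d = double n

+ℝ-comm : ∀ x y → (x +ℝ y) ≈ℝ (y +ℝ x)
+ℝ-comm x y n =
  subst (λ p → ℚ.∣ seq (x +ℝ y) n ℚ.- p ∣ ℚ.≤ ε n ℚ.+ ε n)
    (ℚ.+-comm (seq x (double n)) (seq y (double n)))
    (≈ℝ-refl (x +ℝ y) n)

-- Adding `0ℝ` changes the sequence, since `_+ℝ_` reads `x` at index `double n`. Regularity of `x`
-- between `n` and `double n` bounds the shift.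
x≤x+0 : ∀ x → x ≤ℝ (x +ℝ 0ℝ)
x≤x+0 x n = begin
  seq x n ℚ.- (seq x d ℚ.+ 0ℚ)  ≡⟨ cong (λ p → seq x n ℚ.- p) (ℚ.+-identityʳ (seq x d)) ⟩
  seq x n ℚ.- seq x d           ≤⟨ regular-≤ x n d ⟩
  ε n ℚ.+ ε d                   ≤⟨ ℚ.+-monoʳ-≤ (ε n) (ε-double≤ε n) ⟩
  ε n ℚ.+ ε n                   ∎
  where
  open ℚ.≤-Reasoning
  d = double n

x≤x+y : ∀ x y → 0ℝ ≤ℝ y → x ≤ℝ (x +ℝ y)
x≤x+y x y 0≤y = ≤ℝ-trans x (x +ℝ 0ℝ) (x +ℝ y) (x≤x+0 x)
  (+ℝ-mono-≤ x x 0ℝ y (≤ℝ-refl x) 0≤y)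

x≤y+x : ∀ x y → 0ℝ ≤ℝ y → x ≤ℝ (y +ℝ x)
x≤y+x x y 0≤y = ≤ℝ-trans x (x +ℝ y) (y +ℝ x) (x≤x+y x y 0≤y)
  (≈ℝ⇒≤ℝ (x +ℝ y) (y +ℝ x) (+ℝ-comm x y))

+ℝ-nonNegative : ∀ x y → 0ℝ ≤ℝ x → 0ℝ ≤ℝ y → 0ℝ ≤ℝ (x +ℝ y)
+ℝ-nonNegative x y 0≤x 0≤y = ≤ℝ-trans 0ℝ x (x +ℝ y) 0≤x (x≤x+y x y 0≤y)

<ℝ⇒≱ℝ : ∀ x y → x <ℝ y → ¬ y ≤ℝ x
<ℝ⇒≱ℝ x y (n , 2ε<y-x) y≤x = ℚ.<-irrefl refl (ℚ.<-≤-trans 2ε<y-x (y≤x n))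

-- Positive integers and divisors

≡1⊎>1 : (k : ℕ⁺) → k ≡ 1⁺ ⊎ 1 < value k
≡1⊎>1 (0 , [ () ])
≡1⊎>1 (1 , _) = inj₁ refl
≡1⊎>1 (suc (suc k) , _) = inj₂ (s≤s (s≤s z≤n))

m∣n⇒gcd[m,n]≡m : ∀ {m n} → m ∣ n → gcd m n ≡ m
m∣n⇒gcd[m,n]≡m {m} {n} m∣n = ∣-antisym (gcd[m,n]∣m m n) (gcd-greatest ∣-refl m∣n)

gcd⁺-divisor : ∀ {n} (x : D n) → gcd⁺ (D→ℤ {n} x) n ≡ value x
gcd⁺-divisor {n} (x , [ x∣n ]) =
  -- The divisibility proof carried by an element of `D n` is irrelevant; deciding divisibility
  -- again yields a usable one.
  value-injective (m∣n⇒gcd[m,n]≡m (recompute (value x ∣? value n) x∣n))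

-- Distances given by sums

IsPseudometric-on : ∀ {S T : Set} {d : DistanceFunction T ℝ} (g : S → T) →
                    IsPseudometric d → IsPseudometric (d on g)
IsPseudometric-on g pm = record
  { self-zero = λ x → self-zero (g x)
  ; sym       = λ x y → d-sym (g x) (g y)
  ; triangle  = λ x y z → triangle (g x) (g y) (g z)
  }
  where open IsPseudometric pm renaming (sym to d-sym)

-- An identity, but matching distD f n against d on g here keeps Agda from
-- comparing the two distances by unfolding the reals they denote.
separates-on : ∀ {S T : Set} (d : DistanceFunction T ℝ) (g : S → T) →
               (∀ x y → d (g x) (g y) ≈ℝ 0ℝ → x ≡ y) →
               ∀ x y → (d on g) x y ≈ℝ 0ℝ → x ≡ y
separates-on d g separates = separates

module _ {A : Set} (_≟_ : DecidableEquality A) (g : A → ℝ) where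

  -- For integers and `g x = f (gcd⁺ x n)` this unfolds to `dist f n`. The pseudometric laws need
  -- nothing about `g` beyond nonnegativity.
  sumDist : DistanceFunction A ℝ
  sumDist x y = if does (x ≟ y) then 0ℝ else g x +ℝ g y

  sumDist-≡ : ∀ {x y} → x ≡ y → sumDist x y ≡ 0ℝ
  sumDist-≡ {x} {y} x≡y = cong (if_then 0ℝ else (g x +ℝ g y)) (dec-true (x ≟ y) x≡y)

  sumDist-≢ : ∀ {x y} → x ≢ y → sumDist x y ≡ g x +ℝ g y
  sumDist-≢ {x} {y} x≢y = cong (if_then 0ℝ else (g x +ℝ g y)) (dec-false (x ≟ y) x≢y)

  -- Stated for an explicit decision because abstracting x ≟ y with 'with'
  -- would normalise the rational arithmetic inside _≈ℝ_ and _≤ℝ_.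
  sumDist-elim : ∀ (P : ℝ → Set) {x y} → Dec (x ≡ y) →
                 P 0ℝ → P (g x +ℝ g y) → P (sumDist x y)
  sumDist-elim P (yes x≡y) p₀ p = subst P (sym (sumDist-≡ x≡y)) p₀
  sumDist-elim P (no x≢y)  p₀ p = subst P (sym (sumDist-≢ x≢y)) p

  sumDist-sym : ∀ x y → sumDist x y ≈ℝ sumDist y x
  sumDist-sym x y = by-cases (x ≟ y)
    where
    by-cases : Dec (x ≡ y) → sumDist x y ≈ℝ sumDist y x
    by-cases (yes refl) = ≈ℝ-refl (sumDist x x)
    by-cases (no x≢y)   =
      subst₂ _≈ℝ_ (sym (sumDist-≢ x≢y)) (sym (sumDist-≢ (λ y≡x → x≢y (sym y≡x))))
        (+ℝ-comm (g x) (g y))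

  sumDist≈0⇒sum≤0 : ∀ {x y} → x ≢ y → sumDist x y ≈ℝ 0ℝ → (g x +ℝ g y) ≤ℝ 0ℝ
  sumDist≈0⇒sum≤0 {x} {y} x≢y d≈0 =
    subst (_≤ℝ 0ℝ) (sumDist-≢ x≢y) (≈ℝ⇒≤ℝ (sumDist x y) 0ℝ d≈0)

  module _ (g≥0 : ∀ x → 0ℝ ≤ℝ g x) where

    sumDist-nonNegative : ∀ x y → 0ℝ ≤ℝ sumDist x y
    sumDist-nonNegative x y = sumDist-elim (0ℝ ≤ℝ_) (x ≟ y)
      (≤ℝ-refl 0ℝ) (+ℝ-nonNegative (g x) (g y) (g≥0 x) (g≥0 y))

    -- On the diagonal the distance is zero and the sum is nonnegative. Having the bound there too
    -- spares the triangle inequality a case split on its outer points.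
    sumDist-≤ : ∀ x y → sumDist x y ≤ℝ (g x +ℝ g y)
    sumDist-≤ x y = sumDist-elim (_≤ℝ (g x +ℝ g y)) (x ≟ y)
      (+ℝ-nonNegative (g x) (g y) (g≥0 x) (g≥0 y)) (≤ℝ-refl (g x +ℝ g y))

    sumDist-triangle : ∀ x y z → sumDist x z ≤ℝ (sumDist x y +ℝ sumDist y z)
    sumDist-triangle x y z = by-cases (x ≟ y) (y ≟ z)
      where
      by-cases : Dec (x ≡ y) → Dec (y ≡ z) →
                 sumDist x z ≤ℝ (sumDist x y +ℝ sumDist y z)
      by-cases (yes refl) _ =
        x≤y+x (sumDist x z) (sumDist x x) (sumDist-nonNegative x x)
      by-cases (no _) (yes refl) =
        x≤x+y (sumDist x y) (sumDist y y) (sumDist-nonNegative y y)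
      -- The points `x` and `z` may still coincide here, so only the upper bound `g x +ℝ g z` is
      -- used. Each of its summands then absorbs one copy of `g y`.
      by-cases (no x≢y) (no y≢z) =
        subst (sumDist x z ≤ℝ_) (sym (cong₂ _+ℝ_ (sumDist-≢ x≢y) (sumDist-≢ y≢z)))
          (≤ℝ-trans (sumDist x z) (g x +ℝ g z) ((g x +ℝ g y) +ℝ (g y +ℝ g z))
            (sumDist-≤ x z)
            (+ℝ-mono-≤ (g x) (g x +ℝ g y) (g z) (g y +ℝ g z)
              (x≤x+y (g x) (g y) (g≥0 y))
              (x≤y+x (g z) (g y) (g≥0 y))))

    sumDist-isPseudometric : IsPseudometric sumDist
    sumDist-isPseudometric = record
      { self-zero = λ x → subst (_≈ℝ 0ℝ) (sym (sumDist-≡ {x} refl)) (≈ℝ-refl 0ℝ)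
      ; sym       = sumDist-sym
      ; triangle  = sumDist-triangle
      }

-- The gcd distances of functions in `𝒢` and `𝒢₀`

𝒢-nonNegative : ∀ {f} → 𝒢 f → ∀ k → 0ℝ ≤ℝ f k
𝒢-nonNegative {f} f∈𝒢 k with ≡1⊎>1 k
... | inj₁ refl = ≈ℝ⇒≤ℝ 0ℝ (f 1⁺) (≈ℝ-sym (f 1⁺) 0ℝ (𝒢.f1≈0 f∈𝒢))
... | inj₂ 1<k  = 𝒢.f≥0 f∈𝒢 k 1<k

dist-isPseudometric : ∀ {f} → 𝒢 f → ∀ n → IsPseudometric (dist f n)
dist-isPseudometric {f} f∈𝒢 n =
  sumDist-isPseudometric ℤ._≟_ (λ x → f (gcd⁺ x n)) (λ x → 𝒢-nonNegative f∈𝒢 (gcd⁺ x n))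

distD-isPseudometric : ∀ {f} → 𝒢 f → ∀ n → IsPseudometric (distD f n)
distD-isPseudometric f∈𝒢 n = IsPseudometric-on (D→ℤ {n}) (dist-isPseudometric f∈𝒢 n)

-- At most one of `k`, `l` is 1, so one value of `f` is strictly positive. The other is nonnegative,
-- so the sum dominates the positive one.
𝒢₀-sum≰0 : ∀ {f} → 𝒢₀ f → ∀ k l → k ≢ l → ¬ (f k +ℝ f l) ≤ℝ 0ℝ
𝒢₀-sum≰0 {f} f∈𝒢₀ k l k≢l sum≤0 = by-cases (≡1⊎>1 k) (≡1⊎>1 l)
  where
  open 𝒢₀ f∈𝒢₀
  f≥0 = 𝒢-nonNegative f∈𝒢

  by-cases : k ≡ 1⁺ ⊎ 1 < value k → l ≡ 1⁺ ⊎ 1 < value l → ⊥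
  by-cases (inj₁ k≡1) (inj₁ l≡1) = k≢l (trans k≡1 (sym l≡1))
  by-cases (inj₂ 1<k) _          = <ℝ⇒≱ℝ 0ℝ (f k) (f>0 k 1<k)
    (≤ℝ-trans (f k) (f k +ℝ f l) 0ℝ (x≤x+y (f k) (f l) (f≥0 l)) sum≤0)
  by-cases (inj₁ _)   (inj₂ 1<l) = <ℝ⇒≱ℝ 0ℝ (f l) (f>0 l 1<l)
    (≤ℝ-trans (f l) (f k +ℝ f l) 0ℝ (x≤y+x (f l) (f k) (f≥0 k)) sum≤0)

-- On all of ℤ a vanishing distance determines only the gcd with `n`; distinct integers can share
-- it.
dist≈0⇒gcd⁺≡gcd⁺ : ∀ {f} → 𝒢₀ f → ∀ n i j → dist f n i j ≈ℝ 0ℝ → gcd⁺ i n ≡ gcd⁺ j n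
dist≈0⇒gcd⁺≡gcd⁺ {f} f∈𝒢₀ n i j d≈0 =
  -- Positivity of the sum only refutes that the gcds differ. Equality on `ℕ⁺` is decidable, so this
  -- double negation can be removed without deciding anything about reals.
  decidable-stable (Refinement._≟_ ℕ._≟_ (gcd⁺ i n) (gcd⁺ j n)) λ gcds≢ →
    𝒢₀-sum≰0 f∈𝒢₀ (gcd⁺ i n) (gcd⁺ j n) gcds≢
      (sumDist≈0⇒sum≤0 ℤ._≟_ (λ k → f (gcd⁺ k n)) {i} {j}
        (λ i≡j → gcds≢ (cong (λ k → gcd⁺ k n) i≡j)) d≈0)

-- A divisor of `n` is its own gcd with `n`, so within `D n` the gcd recovers the point.
gcd⁺≡gcd⁺⇒≡ : ∀ n (x y : D n) → gcd⁺ (D→ℤ {n} x) n ≡ gcd⁺ (D→ℤ {n} y) n → x ≡ y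
gcd⁺≡gcd⁺⇒≡ n x y gcds≡ = value-injective
  (trans (sym (gcd⁺-divisor {n} x)) (trans gcds≡ (gcd⁺-divisor {n} y)))

distD-indiscernable : ∀ {f} → 𝒢₀ f → ∀ n (x y : D n) → distD f n x y ≈ℝ 0ℝ → x ≡ y
distD-indiscernable {f} f∈𝒢₀ n = separates-on (dist f n) (D→ℤ {n}) λ x y d≈0 →
  gcd⁺≡gcd⁺⇒≡ n x y (dist≈0⇒gcd⁺≡gcd⁺ f∈𝒢₀ n (D→ℤ {n} x) (D→ℤ {n} y) d≈0)

distD-isMetric : ∀ {f} → 𝒢₀ f → ∀ n → IsMetric (distD f n)
distD-isMetric f∈𝒢₀ n = record
  { isPseudometric = distD-isPseudometric (𝒢₀.f∈𝒢 f∈𝒢₀) n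
  ; indiscernable  = λ {x} {y} → distD-indiscernable f∈𝒢₀ n x y
  }

corollary3p2 : (n : ℕ⁺) → 1 < value n → (f : ℕ⁺ → ℝ) → 𝒢 f →
    IsPseudometric (dist f n) × IsPseudometric (distD f n) × (𝒢₀ f → IsMetric (distD f n))
corollary3p2 n _ f f∈𝒢 =
  dist-isPseudometric f∈𝒢 n , distD-isPseudometric f∈𝒢 n ,
  λ f∈𝒢₀ → distD-isMetric f∈𝒢₀ n
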